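{- If $D$ is a $4$-transitive critical kernel imperfect digraph, then $D\cong\overrightarrow{A}_3$ or $D\cong\overrightarrow{A}_4$.
   Context: All digraphs are finite, with no loops and no multiple arcs (a pair of opposite arcs is allowed). A kernel of $D$ is a set $K\subseteq V(D)$ that is independent (no arcs between its vertices) and absorbent (for every $u\in V(D)\setminus K$ there is $v\in K$ with $(u,v)\in A(D)$). $D$ is critical kernel imperfect if $D$ has no kernel but every proper induced subdigraph of $D$ has a kernel. A $k$-path is a directed path (distinct vertices) of length $k$. $D$ is $4$-transitive if for all vertices $u,v$, the existence of a $4$-path from $u$ to $v$ implies $(u,v)\in A(D)$. For $n\ge3$, $\overrightarrow{A}_n$ is the digraph with vertex set $\mathbb{Z}_n$ and arcs $(i,j)$ for $j-i\in\{1,\dots,n-2\}$ (so $\overrightarrow{A}_3$ is the directed $3$-cycle). -}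

module Defs where

open import Data.Fin using (Fin; zero; suc; fromℕ; inject₁; toℕ)
open import Data.Fin.Subset using (Subset; inside; outside; ⊤; _∈_; _∉_; _⊂_; ∣_∣)
open import Data.Integer using (+_; _-_)
open import Data.Integer.DivMod using (_%ℕ_)
open import Data.Integer.Properties using (+-inverseʳ)
open import Data.Nat using (ℕ; suc; _∸_; _≤_; _≤?_; NonZero; >-nonZero⁻¹)
open import Data.Nat.DivMod using (m<n⇒m%n≡m)
open import Data.Nat.Properties using (n≮0)
open import Data.Product using (Σ; ∃; _×_; _,_)
open import Data.Vec using (_∷_)
open import Function.Bundles using (_↔_; _⇔_; module Inverse)
open import Function.Definitions using (Injective)
open import Level using (0ℓ)
open import Relation.Binary using (Rel; Decidable)
open import Relation.Binary.PropositionalEquality using (_≡_; trans; cong; subst)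
open import Relation.Nullary using (¬_)
open import Relation.Nullary.Decidable using (_×-dec_)

-- Arcs are given by a relation, which rules out multiple arcs; its
-- decidability is part of the data of a finite digraph.
record Digraph : Set₁ where
  field
    order   : ℕ
    Arc     : Rel (Fin order) 0ℓ
    arc?    : Decidable Arc
    noLoops : ∀ v → ¬ Arc v v

  Vertex : Set
  Vertex = Fin order

open Digraph public using (order; Vertex)

module _ (D : Digraph) where
  open Digraph D using (Arc)

  Independent : Subset (order D) → Set
  Independent K = ∀ {u v} → u ∈ K → v ∈ K → ¬ Arc u v

  Absorbent : Subset (order D) → Set
  Absorbent K = ∀ {u} → u ∉ K → ∃ λ v → v ∈ K × Arc u v

  IsKernel : Subset (order D) → Set
  IsKernel K = Independent K × Absorbent K

  HasKernel : Set
  HasKernel = ∃ IsKernel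

  -- A directed path p 0 → p 1 → ⋯ → p k from u to v with distinct vertices.
  record Path (k : ℕ) (u v : Vertex D) : Set where
    field
      vertices : Fin (suc k) → Vertex D
      distinct : Injective _≡_ _≡_ vertices
      source   : vertices zero ≡ u
      target   : vertices (fromℕ k) ≡ v
      arcs     : ∀ (i : Fin k) → Arc (vertices (inject₁ i)) (vertices (suc i))

  Transitive : ℕ → Set
  Transitive k = ∀ u v → Path k u v → Arc u v

-- The increasing enumeration of the elements of S.
element : ∀ {n} (S : Subset n) → Fin ∣ S ∣ → Fin n
element (outside ∷ S) i       = suc (element S i)
element (inside  ∷ S) zero    = zero
element (inside  ∷ S) (suc i) = suc (element S i)

-- The subdigraph induced by S, with the i-th element of S renamed to i.
induced : (D : Digraph) → Subset (order D) → Digraph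
induced D S = record
  { order   = ∣ S ∣
  ; Arc     = λ i j → Arc (element S i) (element S j)
  ; arc?    = λ i j → arc? (element S i) (element S j)
  ; noLoops = λ i → noLoops (element S i)
  }
  where open Digraph D

CriticalKernelImperfect : Digraph → Set
CriticalKernelImperfect D =
  ¬ HasKernel D × (∀ (S : Subset (order D)) → S ⊂ ⊤ → HasKernel (induced D S))

infix 4 _≅_

_≅_ : Digraph → Digraph → Set
D ≅ E = Σ (Vertex D ↔ Vertex E) λ f →
  ∀ u v → Digraph.Arc D u v ⇔ Digraph.Arc E (Inverse.to f u) (Inverse.to f v)

-- The residue of j - i in {0, …, n - 1}, representing the difference in ℤ/n.
difference : ∀ {n} .{{_ : NonZero n}} → Fin n → Fin n → ℕ
difference {n} i j = (+ toℕ j - + toℕ i) %ℕ n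

difference-self : ∀ {n} .{{_ : NonZero n}} (i : Fin n) → difference i i ≡ 0
difference-self {n} i =
  trans (cong (_%ℕ n) (+-inverseʳ (+ toℕ i))) (m<n⇒m%n≡m (>-nonZero⁻¹ n))

-- Only intended for n ≥ 3; for n = 1, 2 there are no arcs.
A⃗ : (n : ℕ) .{{_ : NonZero n}} → Digraph
A⃗ n = record
  { order   = n
  ; Arc     = λ i j → 1 ≤ difference i j × difference i j ≤ n ∸ 2
  ; arc?    = λ i j → (1 ≤? difference i j) ×-dec (difference i j ≤? n ∸ 2)
  ; noLoops = λ i (1≤d , _) → n≮0 (subst (1 ≤_) (difference-self i) 1≤d)
  }

{-# OPTIONS --safe #-}

-- Write u ⇒ v for an asymmetric arc. A nonempty set T closed under ⇒ is all of
-- D: otherwise D[T] has a kernel K, every arc leaving K is answered by an arc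
-- back into K, and K together with a kernel of what K does not absorb is a
-- kernel of D. By 4-transitivity every 5-cycle of D is symmetric, so ⇒ is itself
-- 4-transitive, and a closed ⇒-walk shrinks to a ⇒-cycle of length 3 or 4. An
-- asymmetric triangle is an induced A⃗ 3, which has no kernel, so it is all of D.
-- If a vertex w outside a 4-cycle C satisfies v ⇒ w for some v ∈ C, then C
-- dominates w and {u : v ⇒ u for all v ∈ C} is closed, which is impossible; so
-- C is all of D, and its diagonals are symmetric (A⃗ 4), asymmetric (giving a
-- triangle), or missing (giving a kernel).
module Submission where

open import Defs
open import Data.Empty using (⊥-elim)
open import Data.Fin using (Fin; zero; suc; toℕ)
open import Data.Fin.Patterns using (0F; 1F; 2F; 3F)
open import Data.Fin.Properties using (_≟_; all?; any?; pigeonhole)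
open import Data.Fin.Subset using (Subset; ⊤; ⊥; Nonempty; _∈_; _∉_; inside; outside; _∪_)
open import Data.Fin.Subset.Properties
  using (_∈?_; ∈⊤; ∉⊥; nonempty?; anySubset?; ⊆-max; x∈p∪q⁺; x∈p∪q⁻)
open import Data.Nat using (ℕ; suc; nonZero; _<′_; ≤′-refl; ≤′-step)
open import Data.Nat.GeneralisedArithmetic using (fold)
open import Data.Nat.Properties using (n<1+n; ≤⇒≤′)
open import Data.Product using (∃; ∃₂; _×_; _,_; proj₁; proj₂)
open import Data.Sum using (_⊎_; inj₁; inj₂; [_,_]′)
open import Data.Vec using (Vec; []; _∷_; lookup; tabulate; here; there)
open import Data.Vec.Properties using (lookup∘tabulate; lookup⇒[]=; []=⇒lookup)
open import Data.Vec.Relation.Unary.All using ([]; _∷_)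
open import Data.Vec.Relation.Unary.AllPairs using ([]; _∷_)
open import Data.Vec.Relation.Unary.Unique.Propositional using (Unique)
open import Data.Vec.Relation.Unary.Unique.Propositional.Properties using (lookup-injective)
open import Function using (_∘_; id; case_of_)
open import Function.Bundles using (_⇔_; mk⇔; mk↔ₛ′; module Equivalence)
open import Relation.Binary using (Rel)
open import Relation.Binary.PropositionalEquality
open import Relation.Nullary using (¬_; Dec; yes; no; contradiction; ¬?)
open import Relation.Nullary.Decidable
  using (map′; dec-true; does; from-yes; from-no; decidable-stable; _×-dec_; _⊎-dec_; _→-dec_)
open import Relation.Unary using (Pred; Decidable)

-- Subsets cut out by decidable predicates, and the vertices of an induced subdigraph.

comprehension : ∀ {n p} {P : Pred (Fin n) p} → Decidable P → Subset n
comprehension P? = tabulate (does ∘ P?)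

module _ {n p} {P : Pred (Fin n) p} (P? : Decidable P) where

  ∈-comprehension⁺ : ∀ {v} → P v → v ∈ comprehension P?
  ∈-comprehension⁺ {v} Pv =
    lookup⇒[]= v _ (trans (lookup∘tabulate (does ∘ P?) v) (dec-true (P? v) Pv))

  ∈-comprehension⁻ : ∀ {v} → v ∈ comprehension P? → P v
  ∈-comprehension⁻ {v} v∈ with P? v | trans (sym (lookup∘tabulate (does ∘ P?) v)) ([]=⇒lookup v∈)
  ... | yes Pv | _ = Pv

element∈ : ∀ {n} (S : Subset n) i → element S i ∈ S
element∈ (outside ∷ S) i       = there (element∈ S i)
element∈ (inside  ∷ S) zero    = here
element∈ (inside  ∷ S) (suc i) = there (element∈ S i)

element-onto : ∀ {n} (S : Subset n) {v} → v ∈ S → ∃ λ i → element S i ≡ v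
element-onto (outside ∷ S) (there v∈S) with i , eq ← element-onto S v∈S = i , cong suc eq
element-onto (inside  ∷ S) here        = zero , refl
element-onto (inside  ∷ S) (there v∈S) with i , eq ← element-onto S v∈S = suc i , cong suc eq

-- Decidability of kernels, and kernels relative to a set of vertices.

module _ (D : Digraph) where
  open Digraph D using (Arc; arc?)

  isKernel? : Decidable (IsKernel D)
  isKernel? K = independent? ×-dec absorbent?
    where
    independent? : Dec (Independent D K)
    independent? = map′ (λ h {u} {v} → h u v) (λ h u v → h)
      (all? λ u → all? λ v → (u ∈? K) →-dec (v ∈? K) →-dec ¬? (arc? u v))

    absorbent? : Dec (Absorbent D K)
    absorbent? = map′ (λ h {u} → h u) (λ h u → h)
      (all? λ u → ¬? (u ∈? K) →-dec any? λ v → (v ∈? K) ×-dec arc? u v)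

  hasKernel? : Dec (HasKernel D)
  hasKernel? = anySubset? isKernel?

  Semicomplete : Set
  Semicomplete = ∀ u v → u ≡ v ⊎ Arc u v ⊎ Arc v u

  semicomplete? : Dec Semicomplete
  semicomplete? = all? λ u → all? λ v → (u ≟ v) ⊎-dec arc? u v ⊎-dec arc? v u

  absorbed? : ∀ K → Decidable (λ u → u ∈ K ⊎ ∃ λ v → v ∈ K × Arc u v)
  absorbed? K u = (u ∈? K) ⊎-dec any? λ v → (v ∈? K) ×-dec arc? u v

  -- A kernel of the subdigraph induced on `P`, kept as a subset of the vertices of `D` so that
  -- kernels of different parts can be united.
  KernelOn : ∀ {p} → Pred (Vertex D) p → Pred (Subset (order D)) p
  KernelOn P K = (∀ {u} → u ∈ K → P u) × Independent D K ×
                 (∀ {u} → P u → u ∉ K → ∃ λ v → v ∈ K × Arc u v)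

  kernelOn-nonempty : ∀ {p} {P : Pred (Vertex D) p} {K} → KernelOn P K → ∃ P → Nonempty K
  kernelOn-nonempty {K = K} (_ , _ , K-absorb) (t , Pt) with t ∈? K
  ... | yes t∈K = t , t∈K
  ... | no  t∉K with s , s∈K , _ ← K-absorb Pt t∉K = s , s∈K

-- Critical kernel imperfect digraphs.

module _ (D : Digraph) (critical : CriticalKernelImperfect D) where
  open Digraph D using (Arc; arc?; noLoops)

  kernelFree : ¬ HasKernel D
  kernelFree = proj₁ critical

  someVertex : Vertex D
  someVertex with nonempty? {order D} ⊤
  ... | yes (v , _) = v
  ... | no empty    = ⊥-elim (kernelFree
    (⊥ , (λ u∈⊥ → contradiction u∈⊥ ∉⊥) , λ {u} _ → contradiction (u , ∈⊤) empty))

  -- The excluded vertex `v` makes the set proper; criticality supplies `L`, and `K` is its image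
  -- under `element`.
  properKernel : ∀ {p} {P : Pred (Vertex D) p} (P? : Decidable P) {v} → ¬ P v → ∃ (KernelOn D P)
  properKernel {P = P} P? {v} ¬Pv
    with L , L-indep , L-absorb ← proj₂ critical (comprehension P?)
           (⊆-max _ , v , ∈⊤ , ¬Pv ∘ ∈-comprehension⁻ P?)
    = K , K⊆P , K-indep , K-absorb
    where
    S : Subset (order D)
    S = comprehension P?

    inK? : Decidable (λ u → ∃ λ i → i ∈ L × element S i ≡ u)
    inK? u = any? λ i → (i ∈? L) ×-dec (element S i ≟ u)

    K : Subset (order D)
    K = comprehension inK?

    K⊆P : ∀ {u} → u ∈ K → P u
    K⊆P u∈K with i , _ , refl ← ∈-comprehension⁻ inK? u∈K = ∈-comprehension⁻ P? (element∈ S i)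

    K-indep : Independent D K
    K-indep u∈K v∈K
      with i , i∈L , refl ← ∈-comprehension⁻ inK? u∈K
         | j , j∈L , refl ← ∈-comprehension⁻ inK? v∈K
      = L-indep i∈L j∈L

    K-absorb : ∀ {u} → P u → u ∉ K → ∃ λ v → v ∈ K × Arc u v
    K-absorb Pu u∉K
      with i , refl ← element-onto S (∈-comprehension⁺ P? Pu)
      with j , j∈L , i→j ← L-absorb (λ i∈L → u∉K (∈-comprehension⁺ inK? (i , i∈L , refl)))
      = element S j , ∈-comprehension⁺ inK? (j , j∈L , refl) , i→j

  -- Embedding a kernel-free digraph into `D`.

  module _ (E : Digraph) (f : Vertex E → Vertex D)
           (arcs : ∀ i j → Arc (f i) (f j) ⇔ Digraph.Arc E i j) where
    private module E = Digraph E

    -- Were the image of `f` to miss a vertex, criticality would give a kernel on that image, and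
    -- its preimage would be a kernel of `E`.
    kernelFree⇒onto : ¬ HasKernel E → ∀ v → ∃ λ i → f i ≡ v
    kernelFree⇒onto E-kernelFree v with any? (λ i → f i ≟ v)
    ... | yes v∈f = v∈f
    ... | no  v∉f with K , K⊆f , K-indep , K-absorb ← properKernel (λ u → any? λ i → f i ≟ u) v∉f
      = ⊥-elim (E-kernelFree (L , L-indep , L-absorb))
      where
      inL? : Decidable (λ i → f i ∈ K)
      inL? i = f i ∈? K

      L : Subset (order E)
      L = comprehension inL?

      L-indep : Independent E L
      L-indep i∈L j∈L = K-indep (∈-comprehension⁻ inL? i∈L) (∈-comprehension⁻ inL? j∈L)
                      ∘ Equivalence.from (arcs _ _)

      L-absorb : Absorbent E L
      L-absorb {i} i∉L
        with u , u∈K , i→u ← K-absorb (i , refl) (i∉L ∘ ∈-comprehension⁺ inL?)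
        with j , refl ← K⊆f u∈K
        = j , ∈-comprehension⁺ inL? u∈K , Equivalence.to (arcs i j) i→u

    -- Distinct vertices of `E` are joined by an arc, which `f` would turn into a loop if their
    -- images agreed.
    semicomplete⇒injective : Semicomplete E → ∀ {i j} → f i ≡ f j → i ≡ j
    semicomplete⇒injective semi {i} {j} fi≡fj with semi i j
    ... | inj₁ i≡j        = i≡j
    ... | inj₂ (inj₁ i→j) = contradiction
      (subst (Arc (f i)) (sym fi≡fj) (Equivalence.from (arcs i j) i→j)) (noLoops (f i))
    ... | inj₂ (inj₂ j→i) = contradiction
      (subst (Arc (f j)) fi≡fj (Equivalence.from (arcs j i) j→i)) (noLoops (f j))

    embedding⇒≅ : Semicomplete E → ¬ HasKernel E → D ≅ E
    embedding⇒≅ semi E-kernelFree =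
      mk↔ₛ′ (proj₁ ∘ onto) f (λ i → semicomplete⇒injective semi (proj₂ (onto (f i)))) (proj₂ ∘ onto) ,
      λ u v → subst₂ (λ x y → Arc x y ⇔ E.Arc (proj₁ (onto u)) (proj₁ (onto v)))
                     (proj₂ (onto u)) (proj₂ (onto v)) (arcs _ _)
      where
      onto : ∀ v → ∃ λ i → f i ≡ v
      onto = kernelFree⇒onto E-kernelFree

  -- Asymmetric arcs and sets closed under them.

  infix 4 _⇒_ _⇒?_

  _⇒_ : Rel (Vertex D) _
  u ⇒ v = Arc u v × ¬ Arc v u

  _⇒?_ : ∀ u v → Dec (u ⇒ v)
  u ⇒? v = arc? u v ×-dec ¬? (arc? v u)

  ⇒-irrefl : ∀ {u v} → u ⇒ v → u ≢ v
  ⇒-irrefl (u→u , _) refl = noLoops _ u→u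

  ⇒-no2cycle : ∀ {u v w} → u ⇒ v → v ⇒ w → u ≢ w
  ⇒-no2cycle (u→v , _) (_ , u↛v) refl = u↛v u→v

  module _ {p} {P : Pred (Vertex D) p} (P? : Decidable P)
           (closed : ∀ {u v} → P u → u ⇒ v → P v) where

    -- Opaque because later with-abstractions would normalise the proof term.
    abstract
      closed⇒all : ∃ P → ∀ v → P v
      closed⇒all (t , Pt) v = decidable-stable (P? v) λ ¬Pv → kernelFree (kernel ¬Pv)
        where
        kernel : ¬ P v → HasKernel D
        kernel ¬Pv
          with K , onP@(K⊆P , K-indep , K-absorb) ← properKernel P? ¬Pv
          with k , k∈K ← kernelOn-nonempty D onP (t , Pt)
          -- The vertices outside `K` with no arc into `K` form a proper set, since `k` is not among
          -- them.
          with L , L⊆R , L-indep , L-absorb ← properKernel (¬? ∘ absorbed? D K) (λ ¬A → ¬A (inj₁ k∈K))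
          = K ∪ L , indep , absorb
          where
          -- No arc leads from `r` back to `s`, so an arc from `s` to `r` would be asymmetric;
          -- closure would put `r` in `P`, where `K` absorbs everything.
          K↛L : ∀ {s r} → s ∈ K → r ∈ L → ¬ Arc s r
          K↛L {r = r} s∈K r∈L s→r = L⊆R r∈L (inj₂ (K-absorb Pr λ r∈K → L⊆R r∈L (inj₁ r∈K)))
            where
            Pr : P r
            Pr = closed (K⊆P s∈K) (s→r , λ r→s → L⊆R r∈L (inj₂ (_ , s∈K , r→s)))

          indep : Independent D (K ∪ L)
          indep u∈ v∈ u→v with x∈p∪q⁻ K L u∈ | x∈p∪q⁻ K L v∈
          ... | inj₁ u∈K | inj₁ v∈K = K-indep u∈K v∈K u→v
          ... | inj₁ u∈K | inj₂ v∈L = K↛L u∈K v∈L u→v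
          ... | inj₂ u∈L | inj₁ v∈K = L⊆R u∈L (inj₂ (_ , v∈K , u→v))
          ... | inj₂ u∈L | inj₂ v∈L = L-indep u∈L v∈L u→v

          absorb : Absorbent D (K ∪ L)
          absorb {u} u∉ with absorbed? D K u
          ... | yes (inj₁ u∈K)             = contradiction (x∈p∪q⁺ (inj₁ u∈K)) u∉
          ... | yes (inj₂ (v , v∈K , u→v)) = v , x∈p∪q⁺ (inj₁ v∈K) , u→v
          ... | no  ¬A with v , v∈L , u→v ← L-absorb ¬A (u∉ ∘ x∈p∪q⁺ ∘ inj₂)
            = v , x∈p∪q⁺ (inj₂ v∈L) , u→v

  -- If `u` were a sink of `⇒`, its singleton would be closed, hence all of `D`, and would be a
  -- kernel.
  ⇒-serial : ∀ u → ∃ (u ⇒_)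
  ⇒-serial u with any? (u ⇒?_)
  ... | yes next = next
  ... | no  sink = ⊥-elim (kernelFree (K , indep , absorb))
    where
    K : Subset (order D)
    K = comprehension (u ≟_)

    all≡u : ∀ v → u ≡ v
    all≡u = closed⇒all (u ≟_) (λ { refl u⇒v → contradiction (_ , u⇒v) sink }) (u , refl)

    indep : Independent D K
    indep {x} {y} _ _ x→y = noLoops u (subst₂ Arc (sym (all≡u x)) (sym (all≡u y)) x→y)

    absorb : Absorbent D K
    absorb {x} x∉K = contradiction (∈-comprehension⁺ (u ≟_) (all≡u x)) x∉K

  -- Asymmetric triangles and squares, and the recognition of `A⃗ 3` and `A⃗ 4`.

  Triangle : (x y z : Vertex D) → Set
  Triangle x y z = x ⇒ y × y ⇒ z × z ⇒ x

  Square : (a b c d : Vertex D) → Set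
  Square a b c d = a ⇒ b × b ⇒ c × c ⇒ d × d ⇒ a

  HasTriangle HasSquare : Set
  HasTriangle = ∃₂ λ x y → ∃ λ z → Triangle x y z
  HasSquare   = ∃₂ λ a b → ∃₂ λ c d → Square a b c d

  -- Recursion on the decision lets `arc?` compute at concrete vertices of `A⃗ n`, so each table
  -- entry is just an arc or a non-arc of `D`.
  Agrees : Vertex D → Vertex D → ∀ {B : Set} → Dec B → Set
  Agrees u v (yes _) = Arc u v
  Agrees u v (no _)  = ¬ Arc u v

  agrees⇒⇔ : ∀ {u v} {B : Set} (B? : Dec B) → Agrees u v B? → Arc u v ⇔ B
  agrees⇒⇔ (yes b) u→v = mk⇔ (λ _ → b) (λ _ → u→v)
  agrees⇒⇔ (no ¬b) u↛v = mk⇔ (λ u→v → contradiction u→v u↛v) (λ b → contradiction b ¬b)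

  triangle⇒≅ : HasTriangle → D ≅ A⃗ 3
  triangle⇒≅ (x , y , z , (x→y , y↛x) , (y→z , z↛y) , (z→x , x↛z)) =
    embedding⇒≅ (A⃗ 3) (lookup vs) (λ i j → agrees⇒⇔ (Digraph.arc? (A⃗ 3) i j) (arcs i j))
      -- Both facts are finite checks by evaluation, the second over all eight subsets.
      (from-yes (semicomplete? (A⃗ 3))) (from-no (hasKernel? (A⃗ 3)))
    where
    vs : Vec (Vertex D) 3
    vs = x ∷ y ∷ z ∷ []

    arcs : ∀ i j → Agrees (lookup vs i) (lookup vs j) (Digraph.arc? (A⃗ 3) i j)
    arcs 0F 0F = noLoops x
    arcs 0F 1F = x→y
    arcs 0F 2F = x↛z
    arcs 1F 0F = y↛x
    arcs 1F 1F = noLoops y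
    arcs 1F 2F = y→z
    arcs 2F 0F = z→x
    arcs 2F 1F = z↛y
    arcs 2F 2F = noLoops z

  -- In cyclic order, difference 1 gives the sides, 2 the symmetric diagonals, and 3 the reversed
  -- sides, which asymmetry excludes.
  chordedSquare⇒≅ : ∀ {a b c d} → Square a b c d →
                    Arc a c × Arc c a → Arc b d × Arc d b → D ≅ A⃗ 4
  chordedSquare⇒≅ {a} {b} {c} {d} ((a→b , b↛a) , (b→c , c↛b) , (c→d , d↛c) , (d→a , a↛d))
                  (a→c , c→a) (b→d , d→b) =
    embedding⇒≅ (A⃗ 4) (lookup vs) (λ i j → agrees⇒⇔ (Digraph.arc? (A⃗ 4) i j) (arcs i j))
      (from-yes (semicomplete? (A⃗ 4))) (from-no (hasKernel? (A⃗ 4)))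
    where
    vs : Vec (Vertex D) 4
    vs = a ∷ b ∷ c ∷ d ∷ []

    arcs : ∀ i j → Agrees (lookup vs i) (lookup vs j) (Digraph.arc? (A⃗ 4) i j)
    arcs 0F 0F = noLoops a
    arcs 0F 1F = a→b
    arcs 0F 2F = a→c
    arcs 0F 3F = a↛d
    arcs 1F 0F = b↛a
    arcs 1F 1F = noLoops b
    arcs 1F 2F = b→c
    arcs 1F 3F = b→d
    arcs 2F 0F = c→a
    arcs 2F 1F = c↛b
    arcs 2F 2F = noLoops c
    arcs 2F 3F = c→d
    arcs 3F 0F = d→a
    arcs 3F 1F = d→b
    arcs 3F 2F = d↛c
    arcs 3F 3F = noLoops d

  -- Consequences of 4-transitivity.

  module _ (transitive : Transitive D 4) where

    path⇒arc : ∀ {a b c d e} → Unique (a ∷ b ∷ c ∷ d ∷ e ∷ []) →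
               Arc a b → Arc b c → Arc c d → Arc d e → Arc a e
    path⇒arc {a} {b} {c} {d} {e} unique a→b b→c c→d d→e = transitive a e record
      { vertices = lookup (a ∷ b ∷ c ∷ d ∷ e ∷ [])
      ; distinct = lookup-injective unique _ _
      ; source   = refl
      ; target   = refl
      ; arcs     = λ { 0F → a→b ; 1F → b→c ; 2F → c→d ; 3F → d→e }
      }

    -- An arc e → a would close a 5-cycle, around which the path b c d e a reverses
    -- the arc a → b.
    ⇒-4transitive : ∀ {a b c d e} → a ⇒ b → b ⇒ c → c ⇒ d → d ⇒ e →
                    a ≢ d → b ≢ e → a ≢ e → a ⇒ e
    ⇒-4transitive ab bc cd de a≢d b≢e a≢e =
      path⇒arc ((⇒-irrefl ab ∷ ⇒-no2cycle ab bc ∷ a≢d ∷ a≢e ∷ []) ∷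
                (⇒-irrefl bc ∷ ⇒-no2cycle bc cd ∷ b≢e ∷ []) ∷
                (⇒-irrefl cd ∷ ⇒-no2cycle cd de ∷ []) ∷
                (⇒-irrefl de ∷ []) ∷ [] ∷ [])
               (proj₁ ab) (proj₁ bc) (proj₁ cd) (proj₁ de) ,
      λ e→a → proj₂ ab
        (path⇒arc ((⇒-irrefl bc ∷ ⇒-no2cycle bc cd ∷ b≢e ∷ ≢-sym (⇒-irrefl ab) ∷ []) ∷
                   (⇒-irrefl cd ∷ ⇒-no2cycle cd de ∷ ≢-sym (⇒-no2cycle ab bc) ∷ []) ∷
                   (⇒-irrefl de ∷ ≢-sym a≢d ∷ []) ∷
                   (≢-sym a≢e ∷ []) ∷ [] ∷ [])
                  (proj₁ bc) (proj₁ cd) (proj₁ de) e→a)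

    -- Finding a short asymmetric cycle.

    data ShortWalk (u v : Vertex D) : Set where
      one   : u ⇒ v → ShortWalk u v
      two   : ∀ {x} → u ⇒ x → x ⇒ v → ShortWalk u v
      three : ∀ {x y} → u ⇒ x → x ⇒ y → y ⇒ v → ShortWalk u v

    -- A walk of length four contracts to one arc by `⇒-4transitive`, unless vertices three or four
    -- steps apart coincide, which closes a triangle or a square.
    extend : ∀ {u v w} → ShortWalk u v → v ⇒ w → ShortWalk u w ⊎ HasTriangle ⊎ HasSquare
    extend (one uv)    vw = inj₁ (two uv vw)
    extend (two ux xv) vw = inj₁ (three ux xv vw)
    extend {u} {v} {w} (three {x} ux xy yv) vw with u ≟ v | x ≟ w | u ≟ w
    ... | yes refl | _        | _        = inj₂ (inj₁ (_ , _ , _ , ux , xy , yv))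
    ... | no _     | yes refl | _        = inj₂ (inj₁ (_ , _ , _ , xy , yv , vw))
    ... | no _     | no _     | yes refl = inj₂ (inj₂ (_ , _ , _ , _ , ux , xy , yv , vw))
    ... | no u≢v   | no x≢w   | no u≢w   = inj₁ (one (⇒-4transitive ux xy yv vw u≢v x≢w u≢w))

    orbit : ℕ → Vertex D
    orbit = fold someVertex (proj₁ ∘ ⇒-serial)

    orbit-walk : ∀ {i j} → i <′ j → ShortWalk (orbit i) (orbit j) ⊎ HasTriangle ⊎ HasSquare
    orbit-walk ≤′-refl       = inj₁ (one (proj₂ (⇒-serial _)))
    orbit-walk (≤′-step i<j) =
      [ (λ walk → extend walk (proj₂ (⇒-serial _))) , inj₂ ]′ (orbit-walk i<j)

    -- Two of the first `order D + 1` orbit vertices coincide, so the walk between them is closed;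
    -- asymmetry rules out lengths one and two.
    hasShortCycle : HasTriangle ⊎ HasSquare
    hasShortCycle with i , j , i<j , oᵢ≡oⱼ ← pigeonhole (n<1+n (order D)) (orbit ∘ toℕ)
      = [ close oᵢ≡oⱼ , id ]′ (orbit-walk (≤⇒≤′ i<j))
      where
      close : ∀ {u v} → u ≡ v → ShortWalk u v → HasTriangle ⊎ HasSquare
      close refl (one uu)         = contradiction refl (⇒-irrefl uu)
      close refl (two ux xu)      = contradiction refl (⇒-no2cycle ux xu)
      close refl (three ux xy yu) = inj₁ (_ , _ , _ , ux , xy , yu)

    -- Squares span the digraph, and their diagonals.

    module _ (a b c d : Vertex D) where

      Corner Dominated : Pred (Vertex D) _
      Corner    v = v ≡ a ⊎ v ≡ b ⊎ v ≡ c ⊎ v ≡ d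
      Dominated v = a ⇒ v × b ⇒ v × c ⇒ v × d ⇒ v

      corner? : Decidable Corner
      corner? v = (v ≟ a) ⊎-dec (v ≟ b) ⊎-dec (v ≟ c) ⊎-dec (v ≟ d)

      dominated? : Decidable Dominated
      dominated? v = (a ⇒? v) ×-dec (b ⇒? v) ×-dec (c ⇒? v) ×-dec (d ⇒? v)

    -- Each corner reaches `v` in four steps: through the next two corners, then `u`.
    dominated-closed : ∀ {a b c d u v} → Square a b c d →
                       Dominated a b c d u → u ⇒ v → Dominated a b c d v
    dominated-closed (ab , bc , cd , da) (au , bu , cu , du) uv =
      ⇒-4transitive ab bc cu uv (⇒-irrefl au) (⇒-no2cycle bu uv) (⇒-no2cycle au uv) ,
      ⇒-4transitive bc cd du uv (⇒-irrefl bu) (⇒-no2cycle cu uv) (⇒-no2cycle bu uv) ,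
      ⇒-4transitive cd da au uv (⇒-irrefl cu) (⇒-no2cycle du uv) (⇒-no2cycle cu uv) ,
      ⇒-4transitive da ab bu uv (⇒-irrefl du) (⇒-no2cycle au uv) (⇒-no2cycle du uv)

    -- Being closed and nonempty, the dominated set would contain `a`, forcing a loop at `a`.
    ¬dominated : ∀ {a b c d v} → Square a b c d → ¬ Dominated a b c d v
    ¬dominated {a} {b} {c} {d} {v} s dom = ⇒-irrefl (proj₁ a-dominated) refl
      where
      a-dominated : Dominated a b c d a
      a-dominated = closed⇒all (dominated? a b c d) (dominated-closed s) (v , dom) a

    -- Going round the square from `b` to `a` takes three steps, and `w` is the fourth.
    nextDominates : ∀ {a b c d w} → Square a b c d → b ≢ w → c ≢ w → a ⇒ w → b ⇒ w
    nextDominates (ab , bc , cd , da) b≢w c≢w aw =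
      ⇒-4transitive bc cd da aw (≢-sym (⇒-irrefl ab)) c≢w b≢w

    rotate : ∀ {a b c d} → Square a b c d → Square b c d a
    rotate (ab , bc , cd , da) = bc , cd , da , ab

    cornerDominates⇒dominated : ∀ {a b c d w} → Square a b c d →
      b ≢ w → c ≢ w → d ≢ w → a ≢ w → a ⇒ w → Dominated a b c d w
    cornerDominates⇒dominated s b≢w c≢w d≢w a≢w aw = aw , bw , cw , dw
      where
      bw = nextDominates s b≢w c≢w aw
      cw = nextDominates (rotate s) c≢w d≢w bw
      dw = nextDominates (rotate (rotate s)) d≢w a≢w cw

    square-spans : ∀ {a b c d} → Square a b c d → ∀ v → Corner a b c d v
    square-spans {a} {b} {c} {d} s = closed⇒all (corner? a b c d) closed (a , inj₁ refl)
      where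
      closed : ∀ {u v} → Corner a b c d u → u ⇒ v → Corner a b c d v
      closed {v = w} u∈C uw = decidable-stable (corner? a b c d w) λ w∉C →
        let a≢w = w∉C ∘ inj₁ ∘ sym
            b≢w = w∉C ∘ inj₂ ∘ inj₁ ∘ sym
            c≢w = w∉C ∘ inj₂ ∘ inj₂ ∘ inj₁ ∘ sym
            d≢w = w∉C ∘ inj₂ ∘ inj₂ ∘ inj₂ ∘ sym
            -- Rotation brings the corner that has the arc to `w` into first position.
            s₁ = rotate s ; s₂ = rotate s₁ ; s₃ = rotate s₂
        in case u∈C of λ
          { (inj₁ refl)               → ¬dominated s (cornerDominates⇒dominated s  b≢w c≢w d≢w a≢w uw)
          ; (inj₂ (inj₁ refl))        → ¬dominated s₁ (cornerDominates⇒dominated s₁ c≢w d≢w a≢w b≢w uw)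
          ; (inj₂ (inj₂ (inj₁ refl))) → ¬dominated s₂ (cornerDominates⇒dominated s₂ d≢w a≢w b≢w c≢w uw)
          ; (inj₂ (inj₂ (inj₂ refl))) → ¬dominated s₃ (cornerDominates⇒dominated s₃ a≢w b≢w c≢w d≢w uw)
          }

    -- A one-way diagonal closes a triangle with two sides. With neither arc, `a` and `c` form a
    -- kernel, absorbing `d` and `b` along sides of the square.
    diagonal : ∀ {a b c d} → Square a b c d → HasTriangle ⊎ (Arc a c × Arc c a)
    diagonal {a} {b} {c} {d} s@(ab , bc , cd , da) with arc? a c | arc? c a
    ... | yes a→c | yes c→a = inj₂ (a→c , c→a)
    ... | yes a→c | no  c↛a = inj₁ (_ , _ , _ , (a→c , c↛a) , cd , da)
    ... | no  a↛c | yes c→a = inj₁ (_ , _ , _ , (c→a , a↛c) , ab , bc)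
    ... | no  a↛c | no  c↛a = ⊥-elim (kernelFree (K , indep , absorb))
      where
      inK? : Decidable (λ v → v ≡ a ⊎ v ≡ c)
      inK? v = (v ≟ a) ⊎-dec (v ≟ c)

      K : Subset (order D)
      K = comprehension inK?

      a∈K : a ∈ K
      a∈K = ∈-comprehension⁺ inK? (inj₁ refl)

      c∈K : c ∈ K
      c∈K = ∈-comprehension⁺ inK? (inj₂ refl)

      indep : Independent D K
      indep u∈K v∈K with ∈-comprehension⁻ inK? u∈K | ∈-comprehension⁻ inK? v∈K
      ... | inj₁ refl | inj₁ refl = noLoops a
      ... | inj₁ refl | inj₂ refl = a↛c
      ... | inj₂ refl | inj₁ refl = c↛a
      ... | inj₂ refl | inj₂ refl = noLoops c

      absorb : Absorbent D K
      absorb {u} u∉K with square-spans s u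
      ... | inj₁ refl               = contradiction a∈K u∉K
      ... | inj₂ (inj₁ refl)        = c , c∈K , proj₁ bc
      ... | inj₂ (inj₂ (inj₁ refl)) = contradiction c∈K u∉K
      ... | inj₂ (inj₂ (inj₂ refl)) = a , a∈K , proj₁ da

    square⇒≅ : HasSquare → (D ≅ A⃗ 3) ⊎ (D ≅ A⃗ 4)
    square⇒≅ (_ , _ , _ , _ , s) with diagonal s | diagonal (rotate s)
    ... | inj₁ triangle | _             = inj₁ (triangle⇒≅ triangle)
    ... | inj₂ _        | inj₁ triangle = inj₁ (triangle⇒≅ triangle)
    ... | inj₂ a↔c      | inj₂ b↔d      = inj₂ (chordedSquare⇒≅ s a↔c b↔d)

theorem25 : (D : Digraph) → Transitive D 4 → CriticalKernelImperfect D → (D ≅ A⃗ 3) ⊎ (D ≅ A⃗ 4)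
theorem25 D transitive critical =
  [ inj₁ ∘ triangle⇒≅ D critical , square⇒≅ D critical transitive ]′
    (hasShortCycle D critical transitive)
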